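{- The formulas $\mathrm{Arrow}_{m,n}$ ($m,n\ge3$) have a kernelization with data reduction chains of length at most $C(n+1)$, with a constant $C$ independent of $m,n$, whose safety is witnessed by polynomial-size Frege proofs. Hence: (a) the formulas $\mathrm{Arrow}_{m,n}$ have Frege proofs (of unsatisfiability) of size quasipolynomial in $|\mathrm{Arrow}_{m,n}|$; (b) for every fixed $n\ge3$ there exists a polynomial $p_n(\cdot)$ such that for all $m\ge3$ the formula $\mathrm{Arrow}_{m,n}$ has Frege proofs (of unsatisfiability) of size at most $p_n(|\mathrm{Arrow}_{m,n}|)$.
   Context: There are $n$ agents and $m$ objects, identified with $[m]=\{1,\dots,m\}$. A ranking is a permutation $\pi\in S_m$; $a$ is preferred to $b$ in $\pi$ iff $\pi^{ -1}(a)<\pi^{ -1}(b)$. Let $\mathcal R=S_m^n$ be the set of profiles $R=(R_1,\ldots,R_n)$. The CNF $\mathrm{Arrow}_{m,n}$ has a variable $X_{R,\pi}$ for each $R\in\mathcal R$, $\pi\in S_m$, and the clauses: (i) for each $R$: $\bigvee_{\pi\in S_m}X_{R,\pi}$, and for $\pi_1\ne\pi_2$: $\overline{X_{R,\pi_1}}\vee\overline{X_{R,\pi_2}}$; (ii) (non-dictatorship) for $i=1,\ldots,n$: $\bigvee_{R\in\mathcal R}\overline{X_{R,R_i}}$; (iii) (unanimity) for every two objects $a\neq b$ and every $R$ in which all agents prefer $a$ to $b$: $\bigvee_{\pi:\ \pi^{ -1}(a)<\pi^{ -1}(b)}X_{R,\pi}$; (iv) (independence of irrelevant alternatives) for all $R,R'\in\mathcal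 R$ and objects $a\neq b$ such that every agent ranks $a,b$ in the same way in $R$ and $R'$, and all $\pi_1,\pi_2\in S_m$ that rank $a,b$ in different ways: $\overline{X_{R,\pi_1}}\vee\overline{X_{R',\pi_2}}$. Proof systems. A Frege system is a sound and complete propositional proof system with finitely many axiom schemes and rules (all are polynomially equivalent; fix one whose only rule is modus ponens). The length (size) of a proof is measured by the number of clauses in it. A proof for an unsatisfiable formula means a refutation. A function $f$ is quasipolynomial if $f(N)=O(2^{O(\log^{c} N)})$ for some $c>0$. Witnessing $\Phi_1\vdash\Phi_2$ by Frege proofs means: with disjoint variables $X,Y$ for $\Phi_1,\Phi_2$, there are substitutions $Y_i=\Xi_i[X]$ such that the clauses of $\Phi_2[Y]$, with the substitutions expanded, have a derivation from the clauses of $\Phi_1[X]$. Kernelization. Instances are here the pairs $(m,n)$, with formula $\Phi=\mathrm{Arrow}_{m,n}$; no separate parameter is designated, so the kernel consists of instances of bounded size. The kernelization is obtained by applying finitely many data reduction rules (mapping an instance to an equivalent, not larger one) as long as possible; a data reduction chain is the sequence of instances $x_0=(m,n),x_1,x_2,\ldots$ so obtained, its length being the number of steps. Its safety is witnessed by polynomial-size Frege proofs if there are an integer $R\ge 1$ and a polynomial $h$ such that for each step $x_i\to x_{i+1}$ of the chain of an instance $x$ there are a tautology $\bigvee_{t=1}^{r}\Xi_{i,t}$ with $r\le R$ and formulas $\eta_{i,t}$ isomorphic (up to renaming) to $\Phi(x_{i+1})$ such that this tautology and all implications $\Phi(x_i)\wedge\Xi_{i,t}\vdash\eta_{i,t}$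 have Frege proofs of total size at most $h(|\Phi(x)|)$. -}

module Defs where

open import Data.Bool.Base using (Bool; not; T)
open import Data.Fin.Base using (Fin; _<_)
open import Data.Fin.Properties using (all?; _<?_) renaming (_≟_ to _≟ᶠ_)
open import Data.List.Base as List
  using (List; []; _∷_; _++_; map; foldr; concatMap; mapMaybe; filter; length; cartesianProduct; cartesianProductWith)
open import Data.List.Membership.Propositional using (_∈_)
open import Data.List.Relation.Unary.All using (All)
open import Data.List.Relation.Unary.Any using (Any)
open import Data.Maybe.Base as Maybe using (Maybe)
open import Data.Nat.Base using (ℕ; zero; suc; _+_; _*_; _^_; _≤_; _≥_; _>_)
open import Data.Nat.ListAction using (sum)
open import Data.Nat.Logarithm using (⌊log₂_⌋)
open import Data.Product.Base using (Σ; _×_; _,_; ∃-syntax; uncurry)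
open import Data.Vec.Base using (Vec; []; _∷_; lookup)
open import Data.Vec.Properties using (≡-dec)
open import Function.Base using (_∘_)
open import Function.Bundles using (_↔_; _⇔_; Inverse; mk⇔; Equivalence)
open import Relation.Binary.PropositionalEquality using (_≡_; _≢_; refl)
open import Relation.Nullary.Decidable
  using (Dec; ¬?; map′; dec⇒maybe; _×-dec_; _→-dec_)
open import Relation.Nullary.Negation using (¬_)

-- A permutation π together with π⁻¹, both tabulated: order lists π(1), …, π(m)
-- and rank lists π⁻¹(1), …, π⁻¹(m).  Tables and irrelevant proofs are used
-- instead of Data.Fin.Permutation so that _≡_ is equality of permutations and
-- rankings can index propositional variables.
record Ranking (m : ℕ) : Set where
  constructor ranking
  field
    order : Vec (Fin m) m
    rank  : Vec (Fin m) m
    .inverse : (∀ a → lookup order (lookup rank a) ≡ a) ×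
               (∀ i → lookup rank (lookup order i) ≡ i)

open Ranking public using (order; rank)

Profile : ℕ → ℕ → Set
Profile m n = Vec (Ranking m) n

_≟ᴿ_ : ∀ {m} (π ρ : Ranking m) → Dec (π ≡ ρ)
ranking o r p ≟ᴿ ranking o′ r′ p′ =
  map′ (λ { (refl , refl) → refl }) (λ { refl → refl , refl })
       (≡-dec _≟ᶠ_ o o′ ×-dec ≡-dec _≟ᶠ_ r r′)

allVecs : ∀ {A : Set} → List A → ∀ n → List (Vec A n)
allVecs xs zero    = [] ∷ []
allVecs xs (suc n) = cartesianProductWith _∷_ xs (allVecs xs n)

rankings : ∀ m → List (Ranking m)
rankings m = mapMaybe (uncurry ranking?) (cartesianProduct vecs vecs)
  where
  vecs : List (Vec (Fin m) m)
  vecs = allVecs (List.allFin m) m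

  ranking? : Vec (Fin m) m → Vec (Fin m) m → Maybe (Ranking m)
  ranking? o r = Maybe.map (λ p → ranking o r p)
    (dec⇒maybe (all? (λ a → lookup o (lookup r a) ≟ᶠ a) ×-dec
                all? (λ i → lookup r (lookup o i) ≟ᶠ i)))

profiles : ∀ m n → List (Profile m n)
profiles m n = allVecs (rankings m) n

Prefers : ∀ {m} → Fin m → Fin m → Ranking m → Set
Prefers a b π = lookup (rank π) a < lookup (rank π) b

prefers? : ∀ {m} (a b : Fin m) (π : Ranking m) → Dec (Prefers a b π)
prefers? a b π = lookup (rank π) a <? lookup (rank π) b

SameWay : ∀ {m} → Fin m → Fin m → Ranking m → Ranking m → Set
SameWay a b π ρ = Prefers a b π ⇔ Prefers a b ρ

sameWay? : ∀ {m} (a b : Fin m) (π ρ : Ranking m) → Dec (SameWay a b π ρ)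
sameWay? a b π ρ =
  map′ (uncurry mk⇔) (λ e → Equivalence.to e , Equivalence.from e)
       ((prefers? a b π →-dec prefers? a b ρ) ×-dec
        (prefers? a b ρ →-dec prefers? a b π))

data Literal (V : Set) : Set where
  pos neg : V → Literal V

Clause : Set → Set
Clause V = List (Literal V)

CNF : Set → Set
CNF V = List (Clause V)

∣_∣ : ∀ {V} → CNF V → ℕ
∣ Φ ∣ = sum (map length Φ)

renameLiteral : ∀ {V W : Set} → (V → W) → Literal V → Literal W
renameLiteral ρ (pos v) = pos (ρ v)
renameLiteral ρ (neg v) = neg (ρ v)

renameCNF : ∀ {V W : Set} → (V → W) → CNF V → CNF W
renameCNF ρ = map (map (renameLiteral ρ))

_≅_ : ∀ {V W : Set} → CNF V → CNF W → Set
_≅_ {V} {W} Φ Ψ = Σ (V ↔ W) λ ρ → renameCNF (Inverse.to ρ) Φ ≡ Ψ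

evalLiteral : ∀ {V : Set} → (V → Bool) → Literal V → Bool
evalLiteral α (pos v) = α v
evalLiteral α (neg v) = not (α v)

Satisfiable : ∀ {V : Set} → CNF V → Set
Satisfiable {V} Φ = ∃[ α ] All (Any (λ l → T (evalLiteral {V} α l))) Φ

Var : ℕ → ℕ → Set
Var m n = Profile m n × Ranking m

module _ (m n : ℕ) where

  functionality : CNF (Var m n)
  functionality = concatMap
    (λ R → map (λ π → pos (R , π)) (rankings m)
         ∷ map (λ (π₁ , π₂) → neg (R , π₁) ∷ neg (R , π₂) ∷ [])
               (filter (λ (π₁ , π₂) → ¬? (π₁ ≟ᴿ π₂))
                       (cartesianProduct (rankings m) (rankings m))))
    (profiles m n)

  nonDictatorship : CNF (Var m n)
  nonDictatorship = map
    (λ i → map (λ R → neg (R , lookup R i)) (profiles m n))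
    (List.allFin n)

  objectPairs : List (Fin m × Fin m)
  objectPairs = filter (λ (a , b) → ¬? (a ≟ᶠ b))
                       (cartesianProduct (List.allFin m) (List.allFin m))

  unanimity : CNF (Var m n)
  unanimity = concatMap
    (λ (a , b) →
      map (λ R → map (λ π → pos (R , π)) (filter (prefers? a b) (rankings m)))
          (filter (λ R → all? (λ i → prefers? a b (lookup R i))) (profiles m n)))
    objectPairs

  independence : CNF (Var m n)
  independence = concatMap
    (λ (a , b) → concatMap
      (λ (R , R′) →
        map (λ (π₁ , π₂) → neg (R , π₁) ∷ neg (R′ , π₂) ∷ [])
            (filter (λ (π₁ , π₂) → ¬? (sameWay? a b π₁ π₂))
                    (cartesianProduct (rankings m) (rankings m))))
      (filter (λ (R , R′) → all? (λ i → sameWay? a b (lookup R i) (lookup R′ i)))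
              (cartesianProduct (profiles m n) (profiles m n))))
    objectPairs

  Arrow : CNF (Var m n)
  Arrow = functionality ++ nonDictatorship ++ unanimity ++ independence

infixr 4 _⇒_
infixr 5 _∨_
infixr 6 _∧_

data Formula (V : Set) : Set where
  var         : V → Formula V
  ⊥           : Formula V
  _∧_ _∨_ _⇒_ : Formula V → Formula V → Formula V

~_ : ∀ {V} → Formula V → Formula V
~ A = A ⇒ ⊥

⋁ : ∀ {V} → List (Formula V) → Formula V
⋁ = foldr _∨_ ⊥

literal : ∀ {V} → Literal V → Formula V
literal (pos v) = var v
literal (neg v) = ~ var v

clause : ∀ {V} → Clause V → Formula V
clause C = ⋁ (map literal C)

clauses : ∀ {V} → CNF V → List (Formula V)
clauses = map clause

_[_] : ∀ {V W : Set} → Formula V → (V → Formula W) → Formula W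
var v   [ σ ] = σ v
⊥       [ σ ] = ⊥
(A ∧ B) [ σ ] = (A [ σ ]) ∧ (B [ σ ])
(A ∨ B) [ σ ] = (A [ σ ]) ∨ (B [ σ ])
(A ⇒ B) [ σ ] = (A [ σ ]) ⇒ (B [ σ ])

-- With modus ponens, a standard sound and complete axiomatisation of
-- classical propositional logic.  Ex falso is the instance
-- ⊥ ⇒ (~ A ⇒ ⊥) of k composed with dne.
data Axiom {V : Set} : Formula V → Set where
  k    : ∀ A B   → Axiom (A ⇒ B ⇒ A)
  s    : ∀ A B C → Axiom ((A ⇒ B ⇒ C) ⇒ (A ⇒ B) ⇒ A ⇒ C)
  ∧-i  : ∀ A B   → Axiom (A ⇒ B ⇒ A ∧ B)
  ∧-e₁ : ∀ A B   → Axiom (A ∧ B ⇒ A)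
  ∧-e₂ : ∀ A B   → Axiom (A ∧ B ⇒ B)
  ∨-i₁ : ∀ A B   → Axiom (A ⇒ A ∨ B)
  ∨-i₂ : ∀ A B   → Axiom (B ⇒ A ∨ B)
  ∨-e  : ∀ A B C → Axiom ((A ⇒ C) ⇒ (B ⇒ C) ⇒ A ∨ B ⇒ C)
  dne  : ∀ A     → Axiom (~ ~ A ⇒ A)

-- Frege Γ π: the lines π, listed from last to first, form a Frege derivation
-- from the hypotheses Γ.
data Frege {V : Set} (Γ : List (Formula V)) : List (Formula V) → Set where
  []   : Frege Γ []
  hyp  : ∀ {A π} → A ∈ Γ → Frege Γ π → Frege Γ (A ∷ π)
  ax   : ∀ {A π} → Axiom A → Frege Γ π → Frege Γ (A ∷ π)
  mp   : ∀ {A B π} → (A ⇒ B) ∈ π → A ∈ π → Frege Γ π → Frege Γ (B ∷ π)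

record Derivation {V : Set} (Γ Δ : List (Formula V)) : Set where
  field
    lines   : List (Formula V)
    correct : Frege Γ lines
    derived : All (_∈ lines) Δ

size : ∀ {V} {Γ Δ : List (Formula V)} → Derivation Γ Δ → ℕ
size d = length (Derivation.lines d)

Refutation : ∀ {V} → CNF V → Set
Refutation Φ = Derivation (clauses Φ) (⊥ ∷ [])

record Witnessing {X Y : Set} (Γ : List (Formula X)) (Φ : CNF Y) : Set where
  field
    substitution : Y → Formula X
    derivation   : Derivation Γ (map (_[ substitution ]) (clauses Φ))

-- Coefficients in ascending order.  As polynomials only serve as upper bounds
-- on ℕ, natural coefficients suffice.
Polynomial : Set
Polynomial = List ℕ

evalPoly : Polynomial → ℕ → ℕ
evalPoly p N = foldr (λ a v → a + N * v) 0 p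

-- f(N) = O(2^{O(log^c N)}); a real exponent c may be rounded up, and ⌊log₂ N⌋ is
-- within a constant factor of log N for N ≥ 2.
QuasiPolynomial : (ℕ → ℕ) → Set
QuasiPolynomial f =
  ∃[ c ] c > 0 × (∃[ A ] ∃[ K ] ∃[ N₀ ]
    (∀ N → N ≥ N₀ → f N ≤ A * 2 ^ (K * ⌊log₂ N ⌋ ^ c)))

record Instance : Set where
  constructor inst
  field
    objects   : ℕ
    agents    : ℕ
    objects≥3 : objects ≥ 3
    agents≥3  : agents ≥ 3

open Instance public

VarOf : Instance → Set
VarOf x = Var (objects x) (agents x)

Φ : (x : Instance) → CNF (VarOf x)
Φ x = Arrow (objects x) (agents x)

record DataReductionRule : Set where
  field
    apply      : Instance → Instance
    equivalent : ∀ x → Satisfiable (Φ x) ⇔ Satisfiable (Φ (apply x))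
    notLarger  : ∀ x → objects (apply x) ≤ objects x × agents (apply x) ≤ agents x

open DataReductionRule public

-- A rule applies to x only when it changes x.
data Step (rules : List DataReductionRule) (x : Instance) : Instance → Set where
  step : ∀ {ρ} → ρ ∈ rules → apply ρ x ≢ x → Step rules x (apply ρ x)

Irreducible : List DataReductionRule → Instance → Set
Irreducible rules x = ∀ y → ¬ Step rules x y

data Chain (rules : List DataReductionRule) (x : Instance) : ℕ → Instance → Set where
  start : Chain rules x 0 x
  _▻_   : ∀ {l y z} → Chain rules x l y → Step rules y z → Chain rules x (suc l) z

record Kernelization : Set where
  field
    rules         : List DataReductionRule
    kernelSize    : ℕ
    kernelBounded : ∀ x → Irreducible rules x →
                    objects x ≤ kernelSize × agents x ≤ kernelSize

open Kernelization public

ChainsBoundedBy : Kernelization → (Instance → ℕ) → Set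
ChainsBoundedBy κ bound = ∀ x {l y} → Chain (rules κ) x l y → l ≤ bound x

record Alternative (x y : Instance) : Set₁ where
  field
    Ξ           : Formula (VarOf x)
    Y           : Set
    η           : CNF Y
    isomorphic  : Φ y ≅ η
    implication : Witnessing (Ξ ∷ clauses (Φ x)) η

record StepWitness (x y : Instance) : Set₁ where
  field
    alternatives : List (Alternative x y)
    tautology    : Derivation [] (⋁ (map Alternative.Ξ alternatives) ∷ [])

  totalSize : ℕ
  totalSize = size tautology
    + sum (map (size ∘ Witnessing.derivation ∘ Alternative.implication) alternatives)

SafelyWitnessed : Kernelization → Set₁
SafelyWitnessed κ =
  ∃[ r ] r ≥ 1 × (∃[ h ]
    (∀ x {l y z} → Chain (rules κ) x l y → Step (rules κ) y z →
      Σ (StepWitness y z) λ w →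
        length (StepWitness.alternatives w) ≤ r ×
        StepWitness.totalSize w ≤ evalPoly h ∣ Φ x ∣))

{-# OPTIONS --safe #-}

-- Arrow's theorem is refuted by a clause tableau of polynomial size for all m
-- and n at once; this gives (a) and (b), and it witnesses the safety of the
-- single reduction rule (m , n) ↦ (3 , 3), since any formula follows from ⊥.
-- The tableau branches on the outcomes R ↦ π of single profiles, L = m! ways each.
-- Let S j be the set of agents i ≥ j.  S 0 beats its complement on a fixed pair
-- of objects and S n does not, so searching j = 0, 1, …, n − 1, which takes
-- L ^ n branches, finds a j at which the outcome turns.  Agent j is then a
-- dictator: if some outcome ranks a pair a, b against agent j, branching on
-- boundedly many further profiles closes the branch.  As there are
-- L ^ n ≤ ∣ Arrow m n ∣ profiles, the size is polynomial.
module Submission where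

open import Defs
open import Data.Bool.Base using (Bool; true; false; not; T)
open import Data.Empty as Empty using ()
open import Data.Fin.Base as Fin using (Fin; zero; suc; toℕ; fromℕ<; inject₁)
open import Data.Fin.Induction using (<-weakInduction)
open import Data.Fin.Patterns using (0F; 1F; 2F)
open import Data.Fin.Permutation as Perm using (Permutation′; _⟨$⟩ʳ_; _⟨$⟩ˡ_; _∘ₚ_; transpose)
open import Data.Fin.Properties as Fin using (all?; any?) renaming (_≟_ to _≟ᶠ_)
open import Data.List.Base as List
  using (List; []; _∷_; _++_; map; length; replicate; concatMap; filter;
         cartesianProduct; cartesianProductWith)
open import Data.List.Membership.Propositional using (_∈_)
open import Data.List.Membership.Propositional.Properties
open import Data.List.Properties using (length-++; length-map; length-filter; map-++; map-id; map-cong)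
open import Data.List.Relation.Unary.All as All using (All; []; _∷_)
open import Data.List.Relation.Unary.Any as Any using (Any; here; there)
import Data.List.Relation.Unary.Any.Properties as Any
open import Data.Maybe.Base as Maybe using ()
open import Data.Maybe.Relation.Unary.Any as MAny using (just)
open import Data.Nat.Base using (ℕ; zero; suc; _+_; _*_; _^_; _≤_; _<_; _≥_; z≤n; s≤s; NonZero; >-nonZero)
open import Data.Nat.ListAction using (sum)
open import Data.Nat.ListAction.Properties using (sum-++)
open import Data.Nat.Logarithm using (⌊log₂_⌋; ⌊log₂⌋-mono-≤; ⌊log₂[2^n]⌋≡n)
open import Data.Nat.Properties
open import Data.Nat.Solver using (module +-*-Solver)
open import Data.Product.Base using (Σ; _×_; _,_; ∃-syntax; proj₁; proj₂)
open import Data.Sum.Base using (_⊎_; inj₁; inj₂; [_,_]′)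
open import Data.Unit.Base using (tt)
open import Data.Vec.Base using (Vec; []; _∷_; lookup; tabulate)
open import Data.Vec.Properties using (lookup∘tabulate; tabulate∘lookup; tabulate-cong)
open import Function.Base using (_∘_; id; const)
open import Function.Bundles using (mk⇔; Equivalence)
open import Function.Construct.Identity using (↔-id)
open import Relation.Binary.Definitions using (tri<; tri≈; tri>)
open import Relation.Binary.PropositionalEquality
open import Relation.Nullary.Decidable
  using (Dec; does; yes; no; T?; _×-dec_; _⊎-dec_; _→-dec_; ¬?;
         recompute; dec⇒maybe; decidable-stable; dec-true; dec-false)
open import Relation.Nullary.Negation using (¬_; contradiction; contradiction-irr)

-- Frege derivations

module Soundness {V : Set} (α : V → Bool) where

  ⟦_⟧ : Formula V → Set
  ⟦ var v ⟧ = T (α v)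
  ⟦ ⊥ ⟧     = Empty.⊥
  ⟦ A ∧ B ⟧ = ⟦ A ⟧ × ⟦ B ⟧
  ⟦ A ∨ B ⟧ = ⟦ A ⟧ ⊎ ⟦ B ⟧
  ⟦ A ⇒ B ⟧ = ⟦ A ⟧ → ⟦ B ⟧

  -- Truth values are types, so the classical axiom `dne` is sound only because truth under a
  -- Boolean assignment is decidable.
  ⟦_⟧? : ∀ A → Dec ⟦ A ⟧
  ⟦ var v ⟧? = T? (α v)
  ⟦ ⊥ ⟧?     = no id
  ⟦ A ∧ B ⟧? = ⟦ A ⟧? ×-dec ⟦ B ⟧?
  ⟦ A ∨ B ⟧? = ⟦ A ⟧? ⊎-dec ⟦ B ⟧?
  ⟦ A ⇒ B ⟧? = ⟦ A ⟧? →-dec ⟦ B ⟧?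

  axiom-sound : ∀ {A} → Axiom A → ⟦ A ⟧
  axiom-sound (k A B)     = λ a _ → a
  axiom-sound (s A B C)   = λ f g a → f a (g a)
  axiom-sound (∧-i A B)   = _,_
  axiom-sound (∧-e₁ A B)  = proj₁
  axiom-sound (∧-e₂ A B)  = proj₂
  axiom-sound (∨-i₁ A B)  = inj₁
  axiom-sound (∨-i₂ A B)  = inj₂
  axiom-sound (∨-e A B C) = [_,_]′
  axiom-sound (dne A)     = decidable-stable ⟦ A ⟧?

  frege-sound : ∀ {Γ π} → All ⟦_⟧ Γ → Frege Γ π → All ⟦_⟧ π
  frege-sound Γ⊨ []          = []
  frege-sound Γ⊨ (hyp A∈Γ d) = All.lookup Γ⊨ A∈Γ ∷ frege-sound Γ⊨ d
  frege-sound Γ⊨ (ax a d)    = axiom-sound a ∷ frege-sound Γ⊨ d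
  frege-sound Γ⊨ (mp f a d)  =
    let π⊨ = frege-sound Γ⊨ d in All.lookup π⊨ f (All.lookup π⊨ a) ∷ π⊨

  literal-true : ∀ l → T (evalLiteral α l) → ⟦ literal l ⟧
  literal-true (pos v) t = t
  literal-true (neg v) t v-true with α v
  ... | true = t

  clause-true : ∀ {C} → Any (T ∘ evalLiteral α) C → ⟦ clause C ⟧
  clause-true (here {x = l} t) = inj₁ (literal-true l t)
  clause-true (there t)        = inj₂ (clause-true t)

  clauses-true : ∀ {Ψ} → All (Any (T ∘ evalLiteral α)) Ψ → All ⟦_⟧ (clauses Ψ)
  clauses-true []       = []
  clauses-true (t ∷ ts) = clause-true t ∷ clauses-true ts

-- This turns the refutations built below into the equivalence of instances that a data reduction
-- rule has to provide.
refuted⇒unsatisfiable : ∀ {V} {Ψ : CNF V} → Refutation Ψ → ¬ Satisfiable Ψ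
refuted⇒unsatisfiable d (α , Ψ-true) with Derivation.derived d
... | ⊥∈lines ∷ [] = All.lookup (frege-sound (clauses-true Ψ-true) (Derivation.correct d)) ⊥∈lines
  where open Soundness α

module _ {V : Set} {Γ : List (Formula V)} where

  weaken-⊆ : ∀ {Δ π} → (∀ {A} → A ∈ Γ → A ∈ Δ) → Frege Γ π → Frege Δ π
  weaken-⊆ Γ⊆Δ []          = []
  weaken-⊆ Γ⊆Δ (hyp A∈Γ d) = hyp (Γ⊆Δ A∈Γ) (weaken-⊆ Γ⊆Δ d)
  weaken-⊆ Γ⊆Δ (ax a d)    = ax a (weaken-⊆ Γ⊆Δ d)
  weaken-⊆ Γ⊆Δ (mp f a d)  = mp f a (weaken-⊆ Γ⊆Δ d)

  frege-++ : ∀ {π ρ} → Frege Γ π → Frege Γ ρ → Frege Γ (π ++ ρ)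
  frege-++ []          e = e
  frege-++ (hyp A∈Γ d) e = hyp A∈Γ (frege-++ d e)
  frege-++ (ax a d)    e = ax a (frege-++ d e)
  frege-++ (mp f a d)  e = mp (∈-++⁺ˡ f) (∈-++⁺ˡ a) (frege-++ d e)

-- The line bound is an index, so the types of the combinators do the cost accounting. The
-- conclusion may stand anywhere among the lines, so proofs can simply be concatenated.
record Proof {V : Set} (Γ : List (Formula V)) (A : Formula V) (c : ℕ) : Set where
  constructor proof
  field
    lines      : List (Formula V)
    correct    : Frege Γ lines
    conclusion : A ∈ lines
    bounded    : length lines ≤ c

module _ {V : Set} {Γ : List (Formula V)} where

  relax : ∀ {A c d} → c ≤ d → Proof Γ A c → Proof Γ A d
  relax c≤d (proof π d i b) = proof π d i (≤-trans b c≤d)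

  axiom : ∀ {A} → Axiom A → Proof Γ A 1
  axiom a = proof _ (ax a []) (here refl) ≤-refl

  hypothesis : ∀ {A} → A ∈ Γ → Proof Γ A 1
  hypothesis A∈Γ = proof _ (hyp A∈Γ []) (here refl) ≤-refl

  infixl 5 _·_

  _·_ : ∀ {A B c d} → Proof Γ (A ⇒ B) c → Proof Γ A d → Proof Γ B (1 + (c + d))
  _·_ {c = c} {d} (proof π p i b) (proof ρ q j b′) =
    proof _ (mp (∈-++⁺ˡ i) (∈-++⁺ʳ π j) (frege-++ p q)) (here refl) (s≤s (begin
      length (π ++ ρ)     ≡⟨ length-++ π ⟩
      length π + length ρ ≤⟨ +-mono-≤ b b′ ⟩
      c + d               ∎))
    where open ≤-Reasoning

  const⇒ : ∀ {A B c} → Proof Γ B c → Proof Γ (A ⇒ B) (2 + c)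
  const⇒ p = axiom (k _ _) · p

  compose : ∀ {A B C c d} → Proof Γ (A ⇒ B) c → Proof Γ (B ⇒ C) d → Proof Γ (A ⇒ C) (5 + d + c)
  compose p q = axiom (s _ _ _) · const⇒ q · p

  ex-falso : ∀ {A} → Proof Γ (⊥ ⇒ A) 7
  ex-falso = compose (axiom (k ⊥ _)) (axiom (dne _))

  -- The axiom `s` distributes A over ⊥ ⇒ B, which is what `ex-falso` gives under the premise A.
  refute-pos : ∀ {A B} → Proof Γ (~ A ⇒ A ⇒ B) 11
  refute-pos = axiom (s _ _ _) · const⇒ ex-falso

  refute-neg : ∀ {A B} → Proof Γ (A ⇒ ~ A ⇒ B) 19
  refute-neg = compose (axiom (k _ _)) (axiom (s _ _ _) · refute-pos)

  -- Iterated `∨-e`: each literal pays 3 lines besides its own case (one axiom and two uses of modus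
  -- ponens), and the final 7 treat the empty disjunction ⊥.
  by-cases : ∀ {A c} C → (∀ {l} → l ∈ C → Proof Γ (literal l ⇒ A) c) →
             Proof Γ (clause C ⇒ A) (length C * (3 + c) + 7)
  by-cases         []      p = ex-falso
  by-cases {c = c} (l ∷ C) p =
    relax (≤-reflexive (sym (+-assoc (3 + c) (length C * (3 + c)) 7)))
          (axiom (∨-e _ _ _) · p (here refl) · by-cases C (p ∘ there))

-- Clause tableaux, with costs measured in powers of `L`

module Tableau {V : Set} (Ψ : CNF V) (L : ℕ) (2≤L : 2 ≤ L) where

  open ≤-Reasoning

  instance
    L≢0 : NonZero L
    L≢0 = >-nonZero (≤-trans (s≤s z≤n) 2≤L)

  -- The assumptions of a branch are premises of a nested implication, not hypotheses, so all nodes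
  -- are derived from the same clauses and no deduction theorem enters.
  refutes : List (Literal V) → Formula V
  refutes []      = ⊥
  refutes (l ∷ σ) = literal l ⇒ refutes σ

  -- The exponent grows with length σ, as closing a branch takes O (length σ) lines.
  record Closes (c : ℕ) (σ : List (Literal V)) : Set where
    constructor closing
    field
      node : Proof (clauses Ψ) (refutes σ) (L ^ (c + length σ))

  open Closes public

  closes-mono : ∀ {c d σ} → c ≤ d → Closes c σ → Closes d σ
  closes-mono {σ = σ} c≤d p = closing (relax (^-monoʳ-≤ L (+-monoˡ-≤ (length σ) c≤d)) (node p))

  closing-cost : ∀ i → 19 + i * 6 ≤ L ^ (5 + i)
  closing-cost i = ≤-trans (lemma i) (^-monoˡ-≤ (5 + i) 2≤L)
    where
    lemma : ∀ i → 19 + i * 6 ≤ 2 ^ (5 + i)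
    lemma zero    = ≤ᵇ⇒≤ 19 32 _
    lemma (suc i) = begin
      6 + (19 + i * 6)          ≤⟨ +-mono-≤ (≤-trans (m≤m+n 6 _) (lemma i)) (lemma i) ⟩
      2 ^ (5 + i) + 2 ^ (5 + i) ≡⟨ cong (2 ^ (5 + i) +_) (+-identityʳ _) ⟨
      2 ^ (6 + i)               ∎

  -- Once the contrary literal is met, `refute-neg` applies; every assumption in front of it is
  -- added by composing with `k`, at 6 lines each.
  contrary-neg : ∀ {σ v} → neg v ∈ σ → Proof (clauses Ψ) (var v ⇒ refutes σ) (19 + length σ * 6)
  contrary-neg {_ ∷ σ} (here refl) = relax (m≤m+n 19 _) refute-neg
  contrary-neg         (there i)   = compose (contrary-neg i) (axiom (k _ _))

  contrary-pos : ∀ {σ v} → pos v ∈ σ → Proof (clauses Ψ) (~ var v ⇒ refutes σ) (19 + length σ * 6)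
  contrary-pos {_ ∷ σ} (here refl) = relax (≤-trans (≤ᵇ⇒≤ 11 19 _) (m≤m+n 19 _)) refute-pos
  contrary-pos         (there i)   = compose (contrary-pos i) (axiom (k _ _))

  closed : ∀ {σ v} → pos v ∈ σ → neg v ∈ σ → Closes 5 σ
  closed {σ} p q = closing (relax (closing-cost (length σ)) (closed′ p q))
    where
    -- Descend to the first of the two contrary literals, discharging the assumptions passed with
    -- `k`; the other literal then lies further inside.
    closed′ : ∀ {σ v} → pos v ∈ σ → neg v ∈ σ → Proof (clauses Ψ) (refutes σ) (19 + length σ * 6)
    closed′ {_ ∷ σ} (here refl) (there j)   = relax (+-monoʳ-≤ 19 (m≤n+m _ 6)) (contrary-neg j)
    closed′ {_ ∷ σ} (there i)   (here refl) = relax (+-monoʳ-≤ 19 (m≤n+m _ 6)) (contrary-pos i)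
    closed′ {_ ∷ σ} (there i)   (there j)   =
      relax (+-monoˡ-≤ (19 + length σ * 6) (≤ᵇ⇒≤ 2 6 _)) (const⇒ (closed′ i j))

  splitting-cost : ∀ w x {l} → l ≤ L ^ w →
                   1 + (l * (3 + L ^ x) + 7 + 1) ≤ L ^ (4 + w + x)
  splitting-cost w x {l} l≤W = begin
    1 + (l * (3 + X) + 7 + 1)
      ≤⟨ s≤s (+-monoˡ-≤ 1 (+-monoˡ-≤ 7 (*-monoˡ-≤ (3 + X) l≤W))) ⟩
    1 + (W * (3 + X) + 7 + 1)
      ≡⟨ solve 2 (λ a b → con 1 :+ (a :* (con 3 :+ b) :+ con 7 :+ con 1) :=
                          a :* b :+ con 3 :* (a :* con 1) :+ con 9 :* (con 1 :* con 1)) refl W X ⟩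
    W * X + 3 * (W * 1) + 9 * (1 * 1)
      ≤⟨ +-mono-≤ (+-monoʳ-≤ (W * X) (*-monoʳ-≤ 3 (*-monoʳ-≤ W 1≤X))) (*-monoʳ-≤ 9 (*-mono-≤ 1≤W 1≤X)) ⟩
    W * X + 3 * (W * X) + 9 * (W * X)
      ≡⟨ solve 1 (λ a → a :+ con 3 :* a :+ con 9 :* a := con 13 :* a) refl (W * X) ⟩
    13 * (W * X)
      -- All lower terms are absorbed into W * X with total coefficient 1 + 3 + 9 = 13, and 13 ≤ 2 ^
      -- 4 ≤ L ^ 4 pays for it.
      ≤⟨ *-monoˡ-≤ (W * X) (≤-trans (≤ᵇ⇒≤ 13 16 _) (^-monoˡ-≤ 4 2≤L)) ⟩
    L ^ 4 * (W * X)
      ≡⟨ cong (L ^ 4 *_) (^-distribˡ-+-* L w x) ⟨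
    L ^ 4 * L ^ (w + x)
      ≡⟨ ^-distribˡ-+-* L 4 (w + x) ⟨
    L ^ (4 + w + x) ∎
    where
    open +-*-Solver
    W = L ^ w
    X = L ^ x
    1≤W = m^n>0 L w
    1≤X = m^n>0 L x

  -- Of the constant 5 in the exponent, 4 pays for the overhead of `splitting-cost` and 1 for the
  -- assumption by which each child branch is longer.
  split : ∀ {c σ} w {C} → C ∈ Ψ → length C ≤ L ^ w →
          (∀ {l} → l ∈ C → Closes c (l ∷ σ)) → Closes (5 + w + c) σ
  split {c} {σ} w {C} C∈Ψ |C|≤ closes =
    closing (relax (≤-trans (splitting-cost w (c + suc (length σ)) |C|≤) (≤-reflexive (cong (L ^_) exponent)))
          (by-cases C (node ∘ closes) · hypothesis (∈-map⁺ clause C∈Ψ)))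
    where
    exponent : 4 + w + (c + suc (length σ)) ≡ 5 + w + c + length σ
    exponent = solve 3 (λ w c i → con 4 :+ w :+ (c :+ (con 1 :+ i)) := con 5 :+ w :+ c :+ i)
                     refl w c (length σ)
      where open +-*-Solver

-- Rankings

lookup-ext : ∀ {A : Set} {n} {xs ys : Vec A n} → (∀ i → lookup xs i ≡ lookup ys i) → xs ≡ ys
lookup-ext {xs = xs} {ys} eq =
  trans (sym (tabulate∘lookup xs)) (trans (tabulate-cong eq) (tabulate∘lookup ys))

module _ {m : ℕ} where

  order-rank : ∀ (π : Ranking m) a → lookup (order π) (lookup (rank π) a) ≡ a
  order-rank (ranking o r p) a = recompute (_ ≟ᶠ _) (proj₁ p a)

  rank-order : ∀ (π : Ranking m) i → lookup (rank π) (lookup (order π) i) ≡ i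
  rank-order (ranking o r p) i = recompute (_ ≟ᶠ _) (proj₂ p i)

  rank-injective : ∀ (π : Ranking m) {a b} → lookup (rank π) a ≡ lookup (rank π) b → a ≡ b
  rank-injective π {a} {b} eq =
    trans (sym (order-rank π a)) (trans (cong (lookup (order π)) eq) (order-rank π b))

  rank-ext : ∀ {π ρ : Ranking m} → (∀ a → lookup (rank π) a ≡ lookup (rank ρ) a) → π ≡ ρ
  rank-ext {π} {ρ} eq = equal (lookup-ext orders-agree) (lookup-ext eq)
    where
    orders-agree : ∀ i → lookup (order π) i ≡ lookup (order ρ) i
    orders-agree i = rank-injective ρ
      (trans (sym (eq _)) (trans (rank-order π i) (sym (rank-order ρ i))))

    equal : ∀ {π ρ : Ranking m} → order π ≡ order ρ → rank π ≡ rank ρ → π ≡ ρ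
    equal refl refl = refl

  ≢⇒Prefers : ∀ (π : Ranking m) {a b} → a ≢ b → ¬ Prefers a b π → Prefers b a π
  ≢⇒Prefers π a≢b ¬a<b = ≤∧≢⇒< (≮⇒≥ ¬a<b) (a≢b ∘ sym ∘ rank-injective π ∘ Fin.toℕ-injective)

  Prefers⇒≢ : ∀ (π : Ranking m) {a b} → Prefers a b π → a ≢ b
  Prefers⇒≢ π a<b refl = <-irrefl refl a<b

strictly-monotone⇒≥ : ∀ {m} (f : Fin m → Fin m) → (∀ {i j} → i Fin.< j → f i Fin.< f j) →
                      ∀ i → i Fin.≤ f i
strictly-monotone⇒≥ {suc m} f mono = <-weakInduction (λ i → i Fin.≤ f i) z≤n λ i i≤fi →
  ≤-<-trans (≤-trans (≤-reflexive (sym (Fin.toℕ-inject₁ i))) i≤fi)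
            (mono {inject₁ i} {suc i} (s≤s (≤-reflexive (Fin.toℕ-inject₁ i))))

module _ {m : ℕ} where

  -- Reading off the rank in π of the object at a given place of ρ is a strictly increasing self-map
  -- of `Fin m`, and such a map is nowhere below the identity.
  refines⇒rank-≤ : ∀ (π ρ : Ranking m) → (∀ {a b} → Prefers a b ρ → Prefers a b π) →
                   ∀ a → lookup (rank ρ) a Fin.≤ lookup (rank π) a
  refines⇒rank-≤ π ρ ρ⊆π a =
    subst (λ b → lookup (rank ρ) a Fin.≤ lookup (rank π) b) (order-rank ρ a)
      (strictly-monotone⇒≥ (λ i → lookup (rank π) (lookup (order ρ) i)) mono (lookup (rank ρ) a))
    where
    mono : ∀ {i j} → i Fin.< j →
           lookup (rank π) (lookup (order ρ) i) Fin.< lookup (rank π) (lookup (order ρ) j)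
    mono {i} {j} i<j = ρ⊆π (subst₂ Fin._<_ (sym (rank-order ρ i)) (sym (rank-order ρ j)) i<j)

  refines⇒≡ : ∀ (π ρ : Ranking m) → (∀ {a b} → Prefers a b ρ → Prefers a b π) → π ≡ ρ
  refines⇒≡ π ρ ρ⊆π = rank-ext λ a → Fin.≤-antisym (refines⇒rank-≤ ρ π π⊆ρ a) (refines⇒rank-≤ π ρ ρ⊆π a)
    where
    π⊆ρ : ∀ {a b} → Prefers a b π → Prefers a b ρ
    π⊆ρ {a} {b} a<b with prefers? a b ρ
    ... | yes p = p
    -- Rankings are total: if ρ does not follow π on a, b, then it ranks b first, and so does π,
    -- which refines it.
    ... | no ¬p = contradiction a<b (<-asym (ρ⊆π (≢⇒Prefers ρ (Prefers⇒≢ π a<b) ¬p)))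

  -- This supplies the pair on which an outcome other than the would-be dictator's ranking goes
  -- against that agent.
  ≢⇒disagree : ∀ {π ρ : Ranking m} → π ≢ ρ → ∃[ a ] ∃[ b ] Prefers a b ρ × ¬ Prefers a b π
  ≢⇒disagree {π} {ρ} π≢ρ with any? (λ a → any? (λ b → prefers? a b ρ ×-dec ¬? (prefers? a b π)))
  ... | yes found = found
  ... | no ¬found = contradiction (refines⇒≡ π ρ λ {a} {b} p →
          decidable-stable (prefers? a b π) (λ ¬q → ¬found (a , b , p , ¬q))) π≢ρ

-- Completeness and length of the enumerations

allVecs-complete : ∀ {A : Set} {xs : List A} → (∀ x → x ∈ xs) → ∀ {n} (v : Vec A n) → v ∈ allVecs xs n
allVecs-complete xs-complete []      = here refl
allVecs-complete xs-complete (x ∷ v) =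
  ∈-cartesianProductWith⁺ _∷_ (xs-complete x) (allVecs-complete xs-complete v)

length-cartesianProductWith : ∀ {A B C : Set} (f : A → B → C) xs ys →
                              length (cartesianProductWith f xs ys) ≡ length xs * length ys
length-cartesianProductWith f []       ys = refl
length-cartesianProductWith f (x ∷ xs) ys =
  trans (length-++ (map (f x) ys))
        (cong₂ _+_ (length-map (f x) ys) (length-cartesianProductWith f xs ys))

length-allVecs : ∀ {A : Set} (xs : List A) n → length (allVecs xs n) ≡ length xs ^ n
length-allVecs xs zero    = refl
length-allVecs xs (suc n) =
  trans (length-cartesianProductWith _∷_ xs (allVecs xs n)) (cong (length xs *_) (length-allVecs xs n))

rankings-complete : ∀ {m} (π : Ranking m) → π ∈ rankings m
rankings-complete π@(ranking o r p) =
  Any.mapMaybe⁺ _ _ (Any.map⁺ (Any.map (λ { refl → found inverse? p (λ _ → refl) })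
    (∈-cartesianProduct⁺ (vecs-complete o) (vecs-complete r))))
  where
  vecs-complete : ∀ {m n} (v : Vec (Fin m) n) → v ∈ allVecs (List.allFin m) n
  vecs-complete = allVecs-complete ∈-allFin

  inverse? : Dec ((∀ a → lookup o (lookup r a) ≡ a) × (∀ i → lookup r (lookup o i) ≡ i))
  inverse? = all? (λ a → lookup o (lookup r a) ≟ᶠ a) ×-dec all? (λ i → lookup r (lookup o i) ≟ᶠ i)

  -- The proof stored in a ranking is irrelevant, so it can only exclude the answer `no`. The proof
  -- found by the decision takes its place, and the ranking stays the same.
  found : ∀ {A B : Set} {f : A → B} {b} (a? : Dec A) → .A → (∀ a → b ≡ f a) →
          MAny.Any (b ≡_) (Maybe.map f (dec⇒maybe a?))
  found (yes a) _ b≡f = just (b≡f a)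
  found (no ¬a) a _   = contradiction-irr a ¬a

profiles-complete : ∀ {m n} (R : Profile m n) → R ∈ profiles m n
profiles-complete = allVecs-complete rankings-complete

distinct⇒2≤length : ∀ {A : Set} {x y : A} {xs} → x ≢ y → x ∈ xs → y ∈ xs → 2 ≤ length xs
distinct⇒2≤length x≢y (here refl)            (here refl)            = contradiction refl x≢y
distinct⇒2≤length x≢y (here _)               (there {xs = _ ∷ _} _) = s≤s (s≤s z≤n)
distinct⇒2≤length x≢y (there {xs = _ ∷ _} _) _                      = s≤s (s≤s z≤n)

-- Following p by a transposition of two values moves x to t and leaves alone the objects already
-- placed elsewhere.
relocate : ∀ {m} (p : Permutation′ m) x t → Σ (Permutation′ m) λ q →
           q ⟨$⟩ʳ x ≡ t × (∀ {y} → y ≢ x → p ⟨$⟩ʳ y ≢ t → q ⟨$⟩ʳ y ≡ p ⟨$⟩ʳ y)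
relocate p x t = p ∘ₚ transpose (p ⟨$⟩ʳ x) t , moved , λ y≢x → fixed (y≢x ∘ injective)
  where
  injective : ∀ {y z} → p ⟨$⟩ʳ y ≡ p ⟨$⟩ʳ z → y ≡ z
  injective eq = trans (sym (Perm.inverseˡ p)) (trans (cong (p ⟨$⟩ˡ_) eq) (Perm.inverseˡ p))

  moved : transpose (p ⟨$⟩ʳ x) t ⟨$⟩ʳ (p ⟨$⟩ʳ x) ≡ t
  moved rewrite dec-true (p ⟨$⟩ʳ x ≟ᶠ p ⟨$⟩ʳ x) refl = refl

  fixed : ∀ {i} → i ≢ p ⟨$⟩ʳ x → i ≢ t → transpose (p ⟨$⟩ʳ x) t ⟨$⟩ʳ i ≡ i
  fixed {i} i≢px i≢t rewrite dec-false (i ≟ᶠ p ⟨$⟩ʳ x) i≢px | dec-false (i ≟ᶠ t) i≢t = refl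

fromPermutation : ∀ {m} → Permutation′ m → Ranking m
fromPermutation p = ranking (tabulate (p ⟨$⟩ˡ_)) (tabulate (p ⟨$⟩ʳ_))
  ( (λ a → trans (lookup∘tabulate (p ⟨$⟩ˡ_) _)
                 (trans (cong (p ⟨$⟩ˡ_) (lookup∘tabulate (p ⟨$⟩ʳ_) a)) (Perm.inverseˡ p)))
  , (λ i → trans (lookup∘tabulate (p ⟨$⟩ʳ_) _)
                 (trans (cong (p ⟨$⟩ʳ_) (lookup∘tabulate (p ⟨$⟩ˡ_) i)) (Perm.inverseʳ p))))

-- Three relocations send x, y, z to the ranks 0, 1, 2 in turn; each preserves the earlier ones
-- because its target rank is new.
line-up : ∀ {m} → 3 ≤ m → ∀ {x y z : Fin m} → x ≢ y → y ≢ z → x ≢ z →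
          Σ (Ranking m) λ π → Prefers x y π × Prefers y z π
line-up {suc (suc (suc m))} (s≤s (s≤s (s≤s _))) {x} {y} {z} x≢y y≢z x≢z
  with p , px , _  ← relocate Perm.id x 0F
  with q , qy , q≈ ← relocate p y 1F
  with r , rz , r≈ ← relocate q z 2F =
  fromPermutation r , before rx ry (s≤s z≤n) , before ry rz (s≤s (s≤s z≤n))
  where
  qx : q ⟨$⟩ʳ x ≡ 0F
  qx = trans (q≈ x≢y (λ px′ → 0≢1 (trans (sym px) px′))) px
    where
    0≢1 : _≢_ {A = Fin (3 + m)} 0F 1F
    0≢1 ()

  rx : r ⟨$⟩ʳ x ≡ 0F
  rx = trans (r≈ x≢z (λ qx′ → 0≢2 (trans (sym qx) qx′))) qx
    where
    0≢2 : _≢_ {A = Fin (3 + m)} 0F 2F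
    0≢2 ()

  ry : r ⟨$⟩ʳ y ≡ 1F
  ry = trans (r≈ y≢z (λ qy′ → 1≢2 (trans (sym qy) qy′))) qy
    where
    1≢2 : _≢_ {A = Fin (3 + m)} 1F 2F
    1≢2 ()

  before : ∀ {a b i j} → r ⟨$⟩ʳ a ≡ i → r ⟨$⟩ʳ b ≡ j → i Fin.< j → Prefers a b (fromPermutation r)
  before {a} {b} ra rb = subst₂ Fin._<_ (sym (trans (lookup∘tabulate (r ⟨$⟩ʳ_) a) ra))
                                        (sym (trans (lookup∘tabulate (r ⟨$⟩ʳ_) b) rb))

third : ∀ {m} → 3 ≤ m → ∀ (x y : Fin m) → ∃[ z ] z ≢ x × z ≢ y
third (s≤s (s≤s (s≤s _))) zero          zero          = 1F , (λ ()) , (λ ())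
third (s≤s (s≤s (s≤s _))) zero          (suc zero)    = 2F , (λ ()) , (λ ())
third (s≤s (s≤s (s≤s _))) zero          (suc (suc _)) = 1F , (λ ()) , (λ ())
third (s≤s (s≤s (s≤s _))) (suc zero)    zero          = 2F , (λ ()) , (λ ())
third (s≤s (s≤s (s≤s _))) (suc (suc _)) zero          = 1F , (λ ()) , (λ ())
third (s≤s (s≤s (s≤s _))) (suc _)       (suc _)       = 0F , (λ ()) , (λ ())

three-objects : ∀ {m} → 3 ≤ m → ∃[ x ] ∃[ y ] ∃[ z ] x ≢ y × y ≢ z × _≢_ {A = Fin m} x z
three-objects (s≤s (s≤s (s≤s _))) = 0F , 1F , 2F , (λ ()) , (λ ()) , (λ ())

2≤rankings : ∀ {m} → 3 ≤ m → 2 ≤ length (rankings m)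
2≤rankings 3≤m
  with x , y , z , x≢y , y≢z , x≢z ← three-objects 3≤m
  with π , x<y , _ ← line-up 3≤m x≢y y≢z x≢z
  with ρ , y<x , _ ← line-up 3≤m (x≢y ∘ sym) x≢z y≢z
  = distinct⇒2≤length (λ { refl → <-asym x<y y<x }) (rankings-complete π) (rankings-complete ρ)

-- Arrow's theorem

does-≡⇒→ : ∀ {P Q : Set} (p? : Dec P) (q? : Dec Q) → does p? ≡ does q? → P → Q
does-≡⇒→ p? (yes q) _  p = q
does-≡⇒→ p? (no ¬q) eq p = contradiction (trans (sym (dec-true p? p)) eq) λ ()

-- The positions of an agent on (x , y), on (y , z) and on (x , z) that some
-- ranking realises.
data Compatible : Bool → Bool → Bool → Set where
  same   : ∀ b → Compatible b b b
  differ : ∀ b u → Compatible b (not b) u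

-- If everybody ranks y above z, then a coalition for x over y can be the coalition for x over z as
-- well.
compatible-trueʳ : ∀ b → Compatible b true b
compatible-trueʳ true  = same true
compatible-trueʳ false = differ false false

compatible-trueˡ : ∀ b → Compatible true b b
compatible-trueˡ true  = same true
compatible-trueˡ false = differ true false

module _ {m : ℕ} where

  Position : Fin m → Fin m → Ranking m → Bool
  Position x y π = does (prefers? x y π)

  prefers⇒true : ∀ x y (π : Ranking m) → Prefers x y π → Position x y π ≡ true
  prefers⇒true x y π = dec-true (prefers? x y π)

  prefers⇒false : ∀ x y (π : Ranking m) → Prefers x y π → Position y x π ≡ false
  prefers⇒false x y π x<y = dec-false (prefers? y x π) (<-asym x<y)

  true⇒prefers : ∀ x y (π : Ranking m) → Position x y π ≡ true → Prefers x y π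
  true⇒prefers x y π eq = does-≡⇒→ (yes tt) (prefers? x y π) (sym eq) tt

  Position-flip : ∀ x y (π : Ranking m) {b} → x ≢ y → Position x y π ≡ b → Position y x π ≡ not b
  Position-flip x y π {true}  x≢y eq = prefers⇒false x y π (true⇒prefers x y π eq)
  Position-flip x y π {false} x≢y eq = prefers⇒true y x π
    (≢⇒Prefers π x≢y λ x<y → contradiction (trans (sym eq) (prefers⇒true x y π x<y)) λ ())

  -- The agents outside S are fixed too: for distinct objects they hold the opposite preference.
  -- Hence two profiles with the same coalition on a pair meet the premise of independence.
  Coalition : ∀ {n} → (Fin n → Bool) → Fin m → Fin m → Profile m n → Set
  Coalition S x y R = ∀ i → Position x y (lookup R i) ≡ S i

realise : ∀ {m} → 3 ≤ m → ∀ {x y z : Fin m} → x ≢ y → y ≢ z → x ≢ z → ∀ {p q r} → Compatible p q r →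
          Σ (Ranking m) λ π → Position x y π ≡ p × Position y z π ≡ q × Position x z π ≡ r
realise 3≤m {x} {y} {z} x≢y y≢z x≢z (same true)
  with π , x<y , y<z ← line-up 3≤m x≢y y≢z x≢z =
  π , prefers⇒true x y π x<y , prefers⇒true y z π y<z , prefers⇒true x z π (<-trans x<y y<z)
realise 3≤m {x} {y} {z} x≢y y≢z x≢z (same false)
  with π , z<y , y<x ← line-up 3≤m (y≢z ∘ sym) (x≢y ∘ sym) (x≢z ∘ sym) =
  π , prefers⇒false y x π y<x , prefers⇒false z y π z<y , prefers⇒false z x π (<-trans z<y y<x)
realise 3≤m {x} {y} {z} x≢y y≢z x≢z (differ true true)
  with π , x<z , z<y ← line-up 3≤m x≢z (y≢z ∘ sym) x≢y =
  π , prefers⇒true x y π (<-trans x<z z<y) , prefers⇒false z y π z<y , prefers⇒true x z π x<z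
realise 3≤m {x} {y} {z} x≢y y≢z x≢z (differ true false)
  with π , z<x , x<y ← line-up 3≤m (x≢z ∘ sym) x≢y (y≢z ∘ sym) =
  π , prefers⇒true x y π x<y , prefers⇒false z y π (<-trans z<x x<y) , prefers⇒false z x π z<x
realise 3≤m {x} {y} {z} x≢y y≢z x≢z (differ false true)
  with π , y<x , x<z ← line-up 3≤m (x≢y ∘ sym) x≢z y≢z =
  π , prefers⇒false y x π y<x , prefers⇒true y z π (<-trans y<x x<z) , prefers⇒true x z π x<z
realise 3≤m {x} {y} {z} x≢y y≢z x≢z (differ false false)
  with π , y<z , z<x ← line-up 3≤m y≢z (x≢z ∘ sym) (x≢y ∘ sym) =
  π , prefers⇒false y x π (<-trans y<z z<x) , prefers⇒true y z π y<z , prefers⇒false z x π z<x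

realiseProfile : ∀ {m n} → 3 ≤ m → ∀ {x y z : Fin m} → x ≢ y → y ≢ z → x ≢ z → ∀ {S T U : Fin n → Bool} →
                 (∀ i → Compatible (S i) (T i) (U i)) →
                 Σ (Profile m n) λ R → Coalition S x y R × Coalition T y z R × Coalition U x z R
realiseProfile 3≤m {x} {y} {z} x≢y y≢z x≢z compatible =
  tabulate (proj₁ ∘ agent) ,
  (λ i → trans (cong (Position x y) (lookup∘tabulate (proj₁ ∘ agent) i)) (proj₁ (proj₂ (agent i)))) ,
  (λ i → trans (cong (Position y z) (lookup∘tabulate (proj₁ ∘ agent) i)) (proj₁ (proj₂ (proj₂ (agent i))))) ,
  (λ i → trans (cong (Position x z) (lookup∘tabulate (proj₁ ∘ agent) i)) (proj₂ (proj₂ (proj₂ (agent i)))))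
  where
  agent = λ i → realise 3≤m x≢y y≢z x≢z (compatible i)

realiseCoalition : ∀ {m n} → 3 ≤ m → ∀ {x y : Fin m} → x ≢ y → (S : Fin n → Bool) →
                   Σ (Profile m n) (Coalition S x y)
realiseCoalition 3≤m {x} {y} x≢y S
  with z , z≢x , z≢y ← third 3≤m x y
  with R , S-xy , _ ← realiseProfile 3≤m x≢y (z≢y ∘ sym) (z≢x ∘ sym) (same ∘ S) = R , S-xy

-- Neutrality is proved by changing one object of a pair at a time.
data Path {m} (a b : Fin m) : ℕ → Fin m → Fin m → Set where
  done  : ∀ {l} → Path a b l a b
  left  : ∀ {l x y} z → z ≢ x → z ≢ y → Path a b l z y → Path a b (suc l) x y
  right : ∀ {l x y} z → z ≢ x → z ≢ y → Path a b l x z → Path a b (suc l) x y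

path-right : ∀ {m l} {a b : Fin m} y → a ≢ b → Path a b (suc l) a y
path-right {b = b} y a≢b with b ≟ᶠ y
... | yes refl = done
... | no b≢y   = right b (a≢b ∘ sym) b≢y done

-- Replace x by a, then y by b. Only when y is itself a, and x is not, must y first give way to a
-- third object, which makes three changes.
path : ∀ {m} → 3 ≤ m → ∀ {a b : Fin m} x y → x ≢ y → a ≢ b → Path a b 3 x y
path 3≤m {a} x y x≢y a≢b with a ≟ᶠ x | a ≟ᶠ y
... | yes refl | _        = path-right y a≢b
... | no a≢x   | no a≢y   = left a a≢x a≢y (path-right y a≢b)
... | no a≢x   | yes refl with z , z≢x , z≢a ← third 3≤m x a =
  right z z≢x z≢a (left a a≢x (z≢a ∘ sym) (path-right z a≢b))

atLeast : ∀ {n} → ℕ → Fin n → Bool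
atLeast j i = does (j ≤? toℕ i)

-- The coalition S j and the complement of S (j + 1) together cover all agents and share only agent
-- j. So transitivity binds agent j alone, and the others may rank the outer pair at will.
atLeast-compatible : ∀ j t {u} → (t ≡ j → u ≡ true) →
                     Compatible (does (j ≤? t)) (not (does (suc j ≤? t))) u
atLeast-compatible j t {u} pivotal with <-cmp t j
... | tri< t<j _ _
  rewrite dec-false (j ≤? t) (<⇒≱ t<j)
        | dec-false (suc j ≤? t) (<⇒≱ (<-trans t<j (n<1+n j))) = differ false u
... | tri≈ _ refl _
  rewrite pivotal refl
        | dec-true (j ≤? j) ≤-refl
        | dec-false (suc j ≤? j) (<⇒≱ (n<1+n j)) = same true
... | tri> _ _ j<t
  rewrite dec-true (j ≤? t) (<⇒≤ j<t)
        | dec-true (suc j ≤? t) j<t = differ true u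

concatMap-∈ : ∀ {A B : Set} (f : A → List B) {x y xs} → x ∈ xs → y ∈ f x → y ∈ concatMap f xs
concatMap-∈ f x∈xs y∈fx = ∈-concatMap⁺ f (Any.map (λ { refl → y∈fx }) x∈xs)

∣++∣ : ∀ {V} (Φ₁ Φ₂ : CNF V) → ∣ Φ₁ ++ Φ₂ ∣ ≡ ∣ Φ₁ ∣ + ∣ Φ₂ ∣
∣++∣ Φ₁ Φ₂ = trans (cong sum (map-++ length Φ₁ Φ₂)) (sum-++ (map length Φ₁) (map length Φ₂))

length≤∣concatMap∣ : ∀ {A V : Set} (C : A → Clause V) (Cs : A → CNF V) → (∀ x → 1 ≤ length (C x)) →
                     ∀ xs → length xs ≤ ∣ concatMap (λ x → C x ∷ Cs x) xs ∣
length≤∣concatMap∣ C Cs C≢[] []       = z≤n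
length≤∣concatMap∣ C Cs C≢[] (x ∷ xs) = ≤-trans
  (+-mono-≤ (≤-trans (C≢[] x) (m≤m+n _ ∣ Cs x ∣)) (length≤∣concatMap∣ C Cs C≢[] xs))
  (≤-reflexive (sym (∣++∣ (C x ∷ Cs x) (concatMap (λ x → C x ∷ Cs x) xs))))

-- The tableau refuting `Arrow m n`

module Refute (m n : ℕ) (3≤m : 3 ≤ m) where

  Ψ : CNF (Var m n)
  Ψ = Arrow m n

  L : ℕ
  L = length (rankings m)

  open Tableau Ψ L (2≤rankings 3≤m)

  Assumptions : Set
  Assumptions = List (Literal (Var m n))

  functionality⊆Arrow : ∀ {C} → C ∈ functionality m n → C ∈ Ψ
  functionality⊆Arrow = ∈-++⁺ˡ

  nonDictatorship⊆Arrow : ∀ {C} → C ∈ nonDictatorship m n → C ∈ Ψ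
  nonDictatorship⊆Arrow = ∈-++⁺ʳ (functionality m n) ∘ ∈-++⁺ˡ

  unanimity⊆Arrow : ∀ {C} → C ∈ unanimity m n → C ∈ Ψ
  unanimity⊆Arrow =
    ∈-++⁺ʳ (functionality m n) ∘ ∈-++⁺ʳ (nonDictatorship m n) ∘ ∈-++⁺ˡ

  independence⊆Arrow : ∀ {C} → C ∈ independence m n → C ∈ Ψ
  independence⊆Arrow =
    ∈-++⁺ʳ (functionality m n) ∘ ∈-++⁺ʳ (nonDictatorship m n) ∘ ∈-++⁺ʳ (unanimity m n)

  ∈-objectPairs : ∀ {a b} → a ≢ b → (a , b) ∈ objectPairs m n
  ∈-objectPairs {a} {b} = ∈-filter⁺ _ (∈-cartesianProduct⁺ (∈-allFin a) (∈-allFin b))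

  ∈-rankingPairs : ∀ π ρ → (π , ρ) ∈ cartesianProduct (rankings m) (rankings m)
  ∈-rankingPairs π ρ = ∈-cartesianProduct⁺ (rankings-complete π) (rankings-complete ρ)

  split-outcome : ∀ {c σ} R → (∀ π → Closes c (pos (R , π) ∷ σ)) → Closes (6 + c) σ
  split-outcome R closes =
    split 1 (functionality⊆Arrow (concatMap-∈ _ (profiles-complete R) (here refl)))
      (≤-reflexive (trans (length-map _ (rankings m)) (sym (*-identityʳ L))))
      (case-literal ∘ ∈-map⁻ _)
    where
    case-literal : ∀ {l} → (∃[ π ] π ∈ rankings m × l ≡ pos (R , π)) → Closes _ (l ∷ _)
    case-literal (π , _ , refl) = closes π

  split-binary : ∀ {σ v w} → neg v ∷ neg w ∷ [] ∈ Ψ → pos v ∈ σ → pos w ∈ σ → Closes 11 σ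
  -- The two literals count as at most L ^ 1 branches, each closed at cost 5: 5 + 1 + 5 = 11.
  split-binary C∈Ψ v∈σ w∈σ = split 1 C∈Ψ (≤-trans (2≤rankings 3≤m) (≤-reflexive (sym (*-identityʳ L))))
    λ { (here refl)         → closed (there v∈σ) (here refl)
      ; (there (here refl)) → closed (there w∈σ) (here refl) }

  clash-functionality : ∀ {σ R π ρ} → π ≢ ρ → pos (R , π) ∈ σ → pos (R , ρ) ∈ σ → Closes 11 σ
  clash-functionality {R = R} {π} {ρ} π≢ρ = split-binary (functionality⊆Arrow
    (concatMap-∈ _ (profiles-complete R) (there (∈-map⁺ _ (∈-filter⁺ _ (∈-rankingPairs π ρ) π≢ρ)))))

  -- Every outcome offered by the unanimity clause prefers a to b, hence differs from π, and its
  -- branch closes by functionality: 17 = 6 + 11.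
  clash-unanimity : ∀ {σ R π a b} → a ≢ b → Coalition (const true) a b R → ¬ Prefers a b π →
                    pos (R , π) ∈ σ → Closes 17 σ
  clash-unanimity {σ} {R} {π} {a} {b} a≢b all-ab ¬ab R↦π =
    split 1 (unanimity⊆Arrow (concatMap-∈ _ (∈-objectPairs a≢b)
        (∈-map⁺ _ (∈-filter⁺ _ (profiles-complete R) (λ i → true⇒prefers a b (lookup R i) (all-ab i))))))
      (≤-trans (≤-reflexive (length-map _ (filter (prefers? a b) (rankings m))))
        (≤-trans (length-filter (prefers? a b) (rankings m)) (≤-reflexive (sym (*-identityʳ L)))))
      (case-literal ∘ ∈-map⁻ _)
    where
    case-literal : ∀ {l} → (∃[ ρ ] ρ ∈ filter (prefers? a b) (rankings m) × l ≡ pos (R , ρ)) →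
                   Closes 11 (l ∷ σ)
    case-literal (ρ , ρ∈ , refl) = clash-functionality
      (λ { refl → ¬ab (proj₂ (∈-filter⁻ (prefers? a b) {xs = rankings m} ρ∈)) }) (there R↦π) (here refl)

  clash-independence : ∀ {σ R R′ π π′ S a b} → Coalition S a b R → Coalition S a b R′ →
                       Prefers a b π → ¬ Prefers a b π′ →
                       pos (R , π) ∈ σ → pos (R′ , π′) ∈ σ → Closes 11 σ
  clash-independence {R = R} {R′} {π} {π′} {a = a} {b} S-ab S-ab′ ab ¬ab = split-binary (independence⊆Arrow
    (concatMap-∈ _ (∈-objectPairs (Prefers⇒≢ π ab)) (concatMap-∈ _
      (∈-filter⁺ _ (∈-cartesianProduct⁺ (profiles-complete R) (profiles-complete R′)) same-way)
      (∈-map⁺ _ (∈-filter⁺ _ (∈-rankingPairs π π′) λ e → ¬ab (Equivalence.to e ab))))))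
    where
    same-way : ∀ i → SameWay a b (lookup R i) (lookup R′ i)
    same-way i = mk⇔ (does-≡⇒→ ab? ab′? R≡R′) (does-≡⇒→ ab′? ab? (sym R≡R′))
      where
      ab?  = prefers? a b (lookup R i)
      ab′? = prefers? a b (lookup R′ i)

      R≡R′ : Position a b (lookup R i) ≡ Position a b (lookup R′ i)
      R≡R′ = trans (S-ab i) (sym (S-ab′ i))

  -- A single profile decided on the branch suffices: by independence, a contrary verdict at any
  -- other profile with this coalition on (x , y) closes the branch.
  record Wins (σ : Assumptions) (S : Fin n → Bool) (x y : Fin m) : Set where
    constructor wins
    field
      {profile} : Profile m n
      {outcome} : Ranking m
      assumed   : pos (profile , outcome) ∈ σ
      coalition : Coalition S x y profile
      verdict   : Prefers x y outcome

    distinct : x ≢ y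
    distinct = Prefers⇒≢ outcome verdict

  weaken-wins : ∀ {l σ S x y} → Wins σ S x y → Wins (l ∷ σ) S x y
  weaken-wins (wins R↦π S-xy xy) = wins (there R↦π) S-xy xy

  -- In continuation style: outcomes against unanimity close at once, and each of the others hands
  -- its victory to the rest of the tableau.
  unanimous : ∀ {c σ x y} → x ≢ y → 17 ≤ c →
              (∀ {l} → Wins (l ∷ σ) (const true) x y → Closes c (l ∷ σ)) → Closes (6 + c) σ
  unanimous {x = x} {y} x≢y 17≤c closes
    with R , all-xy ← realiseCoalition 3≤m x≢y (const true) =
    split-outcome R λ ρ → case-outcome ρ (prefers? x y ρ)
    where
    case-outcome : ∀ ρ → Dec (Prefers x y ρ) → Closes _ (pos (_ , ρ) ∷ _)
    case-outcome ρ (yes xy) = closes (wins (here refl) all-xy xy)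
    case-outcome ρ (no ¬xy) = closes-mono 17≤c (clash-unanimity x≢y all-xy ¬xy (here refl))

  -- Choose a profile that realises all three coalitions. Independence forces its outcome to rank x
  -- over y and y over z, so every branch left open ranks x over z.
  transitivity : ∀ {c σ S T U x y z} → Wins σ S x y → Wins σ T y z → x ≢ z →
                 (∀ i → Compatible (S i) (T i) (U i)) → 11 ≤ c →
                 (∀ {l} → Wins (l ∷ σ) U x z → Closes c (l ∷ σ)) → Closes (6 + c) σ
  transitivity {c} {σ} {x = x} {y} {z} W₁ W₂ x≢z compatible 11≤c closes
    with R , S-xy , T-yz , U-xz ← realiseProfile 3≤m (Wins.distinct W₁) (Wins.distinct W₂) x≢z compatible =
    split-outcome R λ ρ → case-outcome ρ (prefers? x z ρ) (prefers? x y ρ) (prefers? y z ρ)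
    where
    case-outcome : ∀ ρ → Dec (Prefers x z ρ) → Dec (Prefers x y ρ) → Dec (Prefers y z ρ) →
                   Closes c (pos (R , ρ) ∷ σ)
    case-outcome ρ (yes xz) _        _        = closes (wins (here refl) U-xz xz)
    case-outcome ρ (no ¬xz) (yes xy) (yes yz) = contradiction (<-trans xy yz) ¬xz
    case-outcome ρ (no _)   (no ¬xy) _        = closes-mono 11≤c
      (clash-independence (Wins.coalition W₁) S-xy (Wins.verdict W₁) ¬xy
        (there (Wins.assumed W₁)) (here refl))
    case-outcome ρ (no _)   (yes _)  (no ¬yz) = closes-mono 11≤c
      (clash-independence (Wins.coalition W₂) T-yz (Wins.verdict W₂) ¬yz
        (there (Wins.assumed W₂)) (here refl))

  -- A victory of S is carried along the path to (a , b), where it contradicts π by independence.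
  -- Changing one object takes a unanimous pair and a use of transitivity, 6 + 6 = 12 in the
  -- exponent.
  neutrality : ∀ {l σ S x y a b R π} → Path a b l x y → Wins σ S x y →
               Coalition S a b R → ¬ Prefers a b π → pos (R , π) ∈ σ → Closes (11 + l * 12) σ
  neutrality done W S-ab ¬ab R↦π = closes-mono (m≤m+n 11 _)
    (clash-independence (Wins.coalition W) S-ab (Wins.verdict W) ¬ab (Wins.assumed W) R↦π)
  neutrality {suc l} {S = S} (left z z≢x z≢y p) W S-ab ¬ab R↦π =
    unanimous z≢x (m≤m+n 17 _) λ W₁ →
    transitivity W₁ (weaken-wins W) z≢y (compatible-trueˡ ∘ S) (m≤m+n 11 _) λ W₂ →
    neutrality p W₂ S-ab ¬ab (there (there R↦π))
  neutrality {suc l} {S = S} (right z z≢x z≢y p) W S-ab ¬ab R↦π =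
    unanimous (z≢y ∘ sym) (m≤m+n 17 _) λ W₁ →
    transitivity (weaken-wins W) W₁ (z≢x ∘ sym) (compatible-trueʳ ∘ S) (m≤m+n 11 _) λ W₂ →
    neutrality p W₂ S-ab ¬ab (there (there R↦π))

  o₀ o₁ o₂ : Fin m
  o₀ = proj₁ (three-objects 3≤m)
  o₁ = proj₁ (proj₂ (three-objects 3≤m))
  o₂ = proj₁ (proj₂ (proj₂ (three-objects 3≤m)))

  o₀≢o₁ : o₀ ≢ o₁
  o₀≢o₁ = proj₁ (proj₂ (proj₂ (proj₂ (three-objects 3≤m))))

  o₁≢o₂ : o₁ ≢ o₂
  o₁≢o₂ = proj₁ (proj₂ (proj₂ (proj₂ (proj₂ (three-objects 3≤m)))))

  o₀≢o₂ : o₀ ≢ o₂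
  o₀≢o₂ = proj₂ (proj₂ (proj₂ (proj₂ (proj₂ (three-objects 3≤m)))))

  -- Agent j turns the election between o₀ and o₁, hence is a dictator: on any
  -- pair (a , b) every coalition containing j wins by neutrality.
  pivotal : ∀ {j σ} → j < n → Wins σ (atLeast j) o₀ o₁ → Wins σ (not ∘ atLeast (suc j)) o₁ o₀ →
            Closes (5 + n + 71) σ
  pivotal {j} {σ} j<n W₀₁ W₁₀ =
    -- The clause has one literal for each of the L ^ n profiles. Each child costs 71: 6 for
    -- splitting the outcome of R, three further splits at 6 each, and 11 + 3 * 12 = 47 for
    -- `neutrality`.
    split n (nonDictatorship⊆Arrow (∈-map⁺ _ (∈-allFin i)))
      (≤-reflexive (trans (length-map _ (profiles m n)) (length-allVecs (rankings m) n)))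
      (case-literal ∘ ∈-map⁻ _)
    where
    i = fromℕ< j<n

    dictator : ∀ R π → Closes 65 (pos (R , π) ∷ neg (R , lookup R i) ∷ σ)
    dictator R π with π ≟ᴿ lookup R i
    ... | yes refl = closes-mono (m≤m+n 5 _) (closed (here refl) (there (here refl)))
    ... | no π≢Rᵢ with a , b , ab , ¬ab ← ≢⇒disagree π≢Rᵢ =
      -- The complement of S (j + 1) wins o₁ over o₀, hence o₁ over o₂. Joined with the victory of S
      -- j for o₀ over o₁, this makes the agents who prefer a to b in R win o₀ over o₂, since agent
      -- j is among them.
      unanimous o₀≢o₂ (m≤m+n 17 _) λ W₀₂ →
      transitivity (weaken-wins (weaken-wins (weaken-wins W₁₀))) W₀₂ o₁≢o₂
        (λ i′ → compatible-trueʳ (not (atLeast (suc j) i′))) (m≤m+n 11 _) λ W₁₂ →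
      transitivity (weaken-wins (weaken-wins (weaken-wins (weaken-wins W₀₁)))) W₁₂ o₀≢o₂
        (λ i′ → atLeast-compatible j (toℕ i′) (i-prefers i′)) (m≤m+n 11 _) λ W₀₂′ →
      neutrality (path 3≤m o₀ o₂ o₀≢o₂ (Prefers⇒≢ (lookup R i) ab)) W₀₂′ (λ _ → refl) ¬ab
        (there (there (there (here refl))))
      where
      i-prefers : ∀ i′ → toℕ i′ ≡ j → Position a b (lookup R i′) ≡ true
      i-prefers i′ i′≡j = subst (λ i → Position a b (lookup R i) ≡ true)
        (Fin.toℕ-injective (trans (Fin.toℕ-fromℕ< j<n) (sym i′≡j))) (prefers⇒true a b (lookup R i) ab)

    case-literal : ∀ {l} → (∃[ R ] R ∈ profiles m n × l ≡ neg (R , lookup R i)) → Closes 71 (l ∷ σ)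
    case-literal (R , _ , refl) = split-outcome R (dictator R)

  search : ∀ r {j σ} → r + j ≡ n → Wins σ (atLeast j) o₀ o₁ → Closes (r * 6 + (5 + n + 71)) σ
  -- Here j = n and S n is empty: all agents prefer o₁ to o₀, yet the assumed outcome ranks o₀
  -- first.
  search zero {j} refl W =
    closes-mono (≤-trans (m≤m+n 17 _) (m≤n+m 71 (5 + n)))
      (clash-unanimity (o₀≢o₁ ∘ sym) nobody (<-asym (Wins.verdict W)) (Wins.assumed W))
    where
    nobody : Coalition (const true) o₁ o₀ (Wins.profile W)
    nobody i = trans (Position-flip o₀ o₁ (lookup (Wins.profile W) i) o₀≢o₁ (Wins.coalition W i))
                     (cong not (dec-false (j ≤? toℕ i) (<⇒≱ (Fin.toℕ<n i))))
  search (suc r) {j} {σ} r+j≡n W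
    with R , S-01 ← realiseCoalition 3≤m o₀≢o₁ (atLeast (suc j)) =
    split-outcome R λ β → case-outcome β (prefers? o₀ o₁ β)
    where
    case-outcome : ∀ β → Dec (Prefers o₀ o₁ β) → Closes (r * 6 + (5 + n + 71)) (pos (R , β) ∷ σ)
    case-outcome β (yes 0<1) = search r (trans (+-suc r j) r+j≡n) (wins (here refl) S-01 0<1)
    -- S j wins but S (j + 1) loses; read on the reversed pair, the loss is a victory of the
    -- complement of S (j + 1).
    case-outcome β (no 0≮1)  = closes-mono (m≤n+m _ (r * 6)) (pivotal
      (m+n≤o⇒n≤o r (≤-reflexive (trans (+-suc r j) r+j≡n)))
      (weaken-wins W)
      (wins (here refl) (λ i → Position-flip o₀ o₁ (lookup R i) o₀≢o₁ (S-01 i)) (≢⇒Prefers β o₀≢o₁ 0≮1)))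

  -- Each profile contributes a nonempty totality clause. This makes a cost L ^ O(n) polynomial in
  -- the size of the formula.
  profiles≤Arrow : L ^ n ≤ ∣ Ψ ∣
  profiles≤Arrow = begin
    L ^ n                         ≡⟨ length-allVecs (rankings m) n ⟨
    length (profiles m n)         ≤⟨ length≤∣concatMap∣ _ _ totality≢[] (profiles m n) ⟩
    ∣ functionality m n ∣         ≤⟨ m≤m+n _ _ ⟩
    ∣ functionality m n ∣ + ∣ nonDictatorship m n ++ unanimity m n ++ independence m n ∣
                                  ≡⟨ ∣++∣ (functionality m n) _ ⟨
    ∣ Ψ ∣                         ∎
    where
    open ≤-Reasoning

    totality≢[] : ∀ R → 1 ≤ length (map (λ π → pos (R , π)) (rankings m))
    totality≢[] R = ≤-trans (≤-trans (s≤s z≤n) (2≤rankings 3≤m))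
                            (≤-reflexive (sym (length-map _ (rankings m))))

  polynomialRefutation : 1 ≤ n → Proof (clauses Ψ) ⊥ (∣ Ψ ∣ ^ 89)
  polynomialRefutation 1≤n = relax cost≤ (node root)
    where
    open ≤-Reasoning

    root : Closes (6 + (n * 6 + (5 + n + 71))) []
    -- `atLeast 0` reduces to `const true`, so the search starts from a unanimous victory.
    root = unanimous o₀≢o₁ (≤-trans (m≤m+n 17 _) (≤-trans (m≤n+m 71 (5 + n)) (m≤n+m _ (n * 6))))
                     (search n (+-identityʳ n))

    -- The exponent is 82 + 7 n, which is at most 89 n for n ≥ 1; hence the degree 89.
    exponent≤ : 6 + (n * 6 + (5 + n + 71)) + 0 ≤ n * 89
    exponent≤ = begin
      6 + (n * 6 + (5 + n + 71)) + 0
        ≡⟨ solve 1 (λ n → con 6 :+ (n :* con 6 :+ (con 5 :+ n :+ con 71)) :+ con 0 :=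
                          con 82 :* con 1 :+ con 7 :* n) refl n ⟩
      82 * 1 + 7 * n
        ≤⟨ +-monoˡ-≤ (7 * n) (*-monoʳ-≤ 82 1≤n) ⟩
      82 * n + 7 * n
        ≡⟨ solve 1 (λ n → con 82 :* n :+ con 7 :* n := n :* con 89) refl n ⟩
      n * 89 ∎
      where open +-*-Solver

    cost≤ : L ^ (6 + (n * 6 + (5 + n + 71)) + 0) ≤ ∣ Ψ ∣ ^ 89
    cost≤ = begin
      L ^ (6 + (n * 6 + (5 + n + 71)) + 0)     ≤⟨ ^-monoʳ-≤ L exponent≤ ⟩
      L ^ (n * 89)                             ≡⟨ ^-*-assoc L n 89 ⟨
      (L ^ n) ^ 89                             ≤⟨ ^-monoˡ-≤ 89 profiles≤Arrow ⟩
      ∣ Ψ ∣ ^ 89                               ∎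

-- Kernelization

monomial : ℕ → Polynomial
monomial d = replicate d 0 ++ 1 ∷ []

evalPoly-monomial : ∀ d N → evalPoly (monomial d) N ≡ N ^ d
evalPoly-monomial zero    N = cong suc (*-zeroʳ N)
evalPoly-monomial (suc d) N = cong (N *_) (evalPoly-monomial d N)

n<2^[1+⌊log₂n⌋] : ∀ n → n < 2 ^ suc ⌊log₂ n ⌋
n<2^[1+⌊log₂n⌋] n = ≰⇒> λ 2^≤n →
  1+n≰n (≤-trans (≤-reflexive (sym (⌊log₂[2^n]⌋≡n (suc ⌊log₂ n ⌋)))) (⌊log₂⌋-mono-≤ 2^≤n))

monomial-quasiPolynomial : ∀ d → QuasiPolynomial (_^ d)
-- The exponent c = 1 is enough; the factor 2 ^ d makes up for rounding the logarithm down.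
monomial-quasiPolynomial d = 1 , s≤s z≤n , 2 ^ d , d , 0 , λ N _ → begin
  N ^ d                              ≤⟨ ^-monoˡ-≤ d (<⇒≤ (n<2^[1+⌊log₂n⌋] N)) ⟩
  (2 ^ suc ⌊log₂ N ⌋) ^ d            ≡⟨ ^-*-assoc 2 (suc ⌊log₂ N ⌋) d ⟩
  2 ^ (d + ⌊log₂ N ⌋ * d)            ≡⟨ cong (λ e → 2 ^ (d + e)) (*-comm ⌊log₂ N ⌋ d) ⟩
  2 ^ (d + d * ⌊log₂ N ⌋)            ≡⟨ cong (λ e → 2 ^ (d + d * e)) (^-identityʳ ⌊log₂ N ⌋) ⟨
  2 ^ (d + d * ⌊log₂ N ⌋ ^ 1)        ≡⟨ ^-distribˡ-+-* 2 d (d * ⌊log₂ N ⌋ ^ 1) ⟩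
  2 ^ d * 2 ^ (d * ⌊log₂ N ⌋ ^ 1)    ∎
  where open ≤-Reasoning

-- The derivation of ⊥ is shared by all conclusions, so its cost c is paid once; each conclusion
-- adds 7 lines for `ex-falso` and one modus ponens.
explosion : ∀ {V} {Γ : List (Formula V)} {c} → Proof Γ ⊥ c → ∀ Δ →
            Σ (Derivation Γ Δ) λ d → size d ≤ c + length Δ * 8
explosion {Γ = Γ} {c} (proof π d ⊥∈π |π|≤c) Δ =
  let ρ , e , _ , Δ⊆ρ , |ρ|≤ = extend Δ in record { lines = ρ ; correct = e ; derived = Δ⊆ρ } , |ρ|≤
  where
  open ≤-Reasoning

  extend : ∀ Δ → ∃[ ρ ] Frege Γ ρ × ⊥ ∈ ρ × All (_∈ ρ) Δ × length ρ ≤ c + length Δ * 8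
  extend []      = π , d , ⊥∈π , [] , ≤-trans |π|≤c (m≤m+n c 0)
  extend (A ∷ Δ) with ρ , e , ⊥∈ρ , Δ⊆ρ , |ρ|≤ ← extend Δ with proof σ f i |σ|≤7 ← ex-falso {Γ = Γ} {A} =
    A ∷ σ ++ ρ , mp (∈-++⁺ˡ i) (∈-++⁺ʳ σ ⊥∈ρ) (frege-++ f e) , there (∈-++⁺ʳ σ ⊥∈ρ) ,
    here refl ∷ All.map (there ∘ ∈-++⁺ʳ σ) Δ⊆ρ , (begin
      suc (length (σ ++ ρ))        ≡⟨ cong suc (length-++ σ) ⟩
      suc (length σ + length ρ)    ≤⟨ s≤s (+-mono-≤ |σ|≤7 |ρ|≤) ⟩
      8 + (c + length Δ * 8)       ≡⟨ +-comm 8 _ ⟩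
      c + length Δ * 8 + 8         ≡⟨ +-assoc c _ 8 ⟩
      c + (length Δ * 8 + 8)       ≡⟨ cong (c +_) (+-comm _ 8) ⟩
      c + (8 + length Δ * 8)       ∎)

≅-refl : ∀ {V} (Ψ : CNF V) → Ψ ≅ Ψ
≅-refl Ψ = ↔-id _ , trans (map-cong (λ C → trans (map-cong rename-id C) (map-id C)) Ψ) (map-id Ψ)
  where
  rename-id : ∀ {V} (l : Literal V) → renameLiteral id l ≡ l
  rename-id (pos v) = refl
  rename-id (neg v) = refl

refuteArrow : ∀ m n → m ≥ 3 → n ≥ 3 → Proof (clauses (Arrow m n)) ⊥ (∣ Arrow m n ∣ ^ 89)
refuteArrow m n m≥3 n≥3 = Refute.polynomialRefutation m n m≥3 (≤-trans (s≤s z≤n) n≥3)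

refuteΦ : ∀ x → Proof (clauses (Φ x)) ⊥ (∣ Φ x ∣ ^ 89)
refuteΦ x = refuteArrow (objects x) (agents x) (objects≥3 x) (agents≥3 x)

toRefutation : ∀ {V} {Ψ : CNF V} {c} → Proof (clauses Ψ) ⊥ c → Σ (Refutation Ψ) λ d → size d ≤ c
toRefutation (proof π d ⊥∈π |π|≤c) = record { lines = π ; correct = d ; derived = ⊥∈π ∷ [] } , |π|≤c

Φ-unsatisfiable : ∀ x → ¬ Satisfiable (Φ x)
Φ-unsatisfiable x = refuted⇒unsatisfiable (proj₁ (toRefutation (refuteΦ x)))

-- Any instance that is smallest in both coordinates can serve as the kernel; at the end it is (3 ,
-- 3).
module Collapse (kernel : Instance)
                (kernel-minimal : ∀ x → objects kernel ≤ objects x × agents kernel ≤ agents x) where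

  collapse : DataReductionRule
  collapse = record
    { apply      = λ _ → kernel
    ; equivalent = λ x → mk⇔ (λ sat → contradiction sat (Φ-unsatisfiable x))
                             (λ sat → contradiction sat (Φ-unsatisfiable kernel))
    ; notLarger  = kernel-minimal
    }

  kernelization : Kernelization
  kernelization = record
    { rules         = collapse ∷ []
    ; kernelSize    = objects kernel + agents kernel
    ; kernelBounded = λ x irreducible →
        -- An x beyond the bound differs from the kernel, so the rule would apply to it.
        -- Decidability of the bound takes the place of deciding whether x is the kernel.
        decidable-stable (objects x ≤? _ ×-dec agents x ≤? _) λ large →
        irreducible kernel (step (here refl) λ { refl → large (m≤m+n _ _ , m≤n+m _ _) })
    }

  -- After one step the instance is the kernel, which the rule leaves unchanged, so no second step
  -- exists.
  chains-bounded : ChainsBoundedBy kernelization (λ x → 1 * (agents x + 1))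
  chains-bounded x start = z≤n
  chains-bounded x (start ▻ _) = ≤-trans (m≤n+m 1 (agents x)) (≤-reflexive (sym (*-identityˡ _)))
  chains-bounded x ((_ ▻ step (here refl) _) ▻ step (here refl) kernel≢kernel) =
    contradiction refl kernel≢kernel

  trivialAlternative : ∀ x {c} → Proof (clauses (Φ x)) ⊥ c →
                       Σ (Alternative x kernel) λ a → Alternative.Ξ a ≡ ~ ⊥ ×
                       size (Witnessing.derivation (Alternative.implication a)) ≤ c + length (Φ kernel) * 8
  trivialAlternative x {c} (proof π e ⊥∈π |π|≤c) =
    let E , |E|≤ = explosion {Γ = ~ ⊥ ∷ clauses (Φ x)} (proof π (weaken-⊆ there e) ⊥∈π |π|≤c)
                             (map (_[ (λ _ → ⊥) ]) (clauses (Φ kernel)))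
    in record
      -- A single case with a trivially true condition: Φ x alone yields ⊥, from which the clauses
      -- of the kernel follow under any substitution, here the constant ⊥.
      { Ξ           = ~ ⊥
      ; Y           = VarOf kernel
      ; η           = Φ kernel
      ; isomorphic  = ≅-refl (Φ kernel)
      ; implication = record { substitution = λ _ → ⊥ ; derivation = E }
      } , refl , ≤-trans |E|≤ (≤-reflexive (cong (λ l → c + l * 8)
           (trans (length-map (_[ (λ _ → ⊥) ]) (clauses (Φ kernel))) (length-map clause (Φ kernel)))))

  stepWitness : ∀ x {c} → Proof (clauses (Φ x)) ⊥ c →
                Σ (StepWitness x kernel) λ w → length (StepWitness.alternatives w) ≤ 1 ×
                StepWitness.totalSize w ≤ (9 + length (Φ kernel) * 8) + c
  -- `ex-falso` at ⊥ proves ⊥ ⇒ ⊥, that is ~ ⊥, and `∨-i₁` turns it into the one-member disjunction: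
  -- 1 + 7 + 1 = 9 lines.
  stepWitness x {c} refutation = combine (trivialAlternative x refutation) (axiom (∨-i₁ (~ ⊥) ⊥) · ex-falso)
    where
    open ≤-Reasoning

    combine : (Σ (Alternative x kernel) λ a → Alternative.Ξ a ≡ ~ ⊥ ×
                size (Witnessing.derivation (Alternative.implication a)) ≤ c + length (Φ kernel) * 8) →
              Proof [] (~ ⊥ ∨ ⊥) 9 →
              Σ (StepWitness x kernel) λ w → length (StepWitness.alternatives w) ≤ 1 ×
              StepWitness.totalSize w ≤ (9 + length (Φ kernel) * 8) + c
    combine (a , Ξ≡ , |a|≤) (proof τ f i |τ|≤9) = record
      { alternatives = a ∷ []
      ; tautology    = record { lines = τ ; correct = f ; derived = subst (λ A → A ∨ ⊥ ∈ τ) (sym Ξ≡) i ∷ [] }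
      } , s≤s z≤n , (begin
        length τ + (sizeOf a + 0)             ≡⟨ cong (length τ +_) (+-identityʳ (sizeOf a)) ⟩
        length τ + sizeOf a                   ≤⟨ +-mono-≤ |τ|≤9 |a|≤ ⟩
        9 + (c + length (Φ kernel) * 8)       ≡⟨ cong (9 +_) (+-comm c _) ⟩
        9 + (length (Φ kernel) * 8 + c)       ≡⟨ +-assoc 9 (length (Φ kernel) * 8) c ⟨
        (9 + length (Φ kernel) * 8) + c       ∎)
      where
      sizeOf : Alternative x kernel → ℕ
      sizeOf a = size (Witnessing.derivation (Alternative.implication a))

  safe : SafelyWitnessed kernelization
  -- The constant term covers the tautology and the clauses of the kernel. Prepending it shifts
  -- `monomial 88` to N ^ 89, the cost of refuting Φ x.
  safe = 1 , s≤s z≤n , (9 + length (Φ kernel) * 8) ∷ monomial 88 , witness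
    where
    witness : ∀ x {l y z} → Chain (rules kernelization) x l y → Step (rules kernelization) y z →
              Σ (StepWitness y z) λ w → length (StepWitness.alternatives w) ≤ 1 ×
              StepWitness.totalSize w ≤ evalPoly ((9 + length (Φ kernel) * 8) ∷ monomial 88) ∣ Φ x ∣
    witness x (_ ▻ step (here refl) _) (step (here refl) kernel≢kernel) = contradiction refl kernel≢kernel
    witness x start                    (step (here refl) _) = stepWitness x
      (relax (≤-reflexive (cong (∣ Φ x ∣ *_) (sym (evalPoly-monomial 88 ∣ Φ x ∣)))) (refuteΦ x))

theorem6 : (Σ Kernelization λ κ →
    (∃[ C ] ChainsBoundedBy κ (λ x → C * (agents x + 1))) × SafelyWitnessed κ)
    × (∃[ f ] QuasiPolynomial f ×
    (∀ m n → m ≥ 3 → n ≥ 3 →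
    Σ (Refutation (Arrow m n)) λ d → size d ≤ f ∣ Arrow m n ∣))
    × (∀ n → n ≥ 3 → Σ Polynomial λ p →
    (∀ m → m ≥ 3 →
    Σ (Refutation (Arrow m n)) λ d → size d ≤ evalPoly p ∣ Arrow m n ∣))
theorem6 =
  (kernelization , (1 , chains-bounded) , safe) ,
  ((_^ 89) , monomial-quasiPolynomial 89 , λ m n m≥3 n≥3 → toRefutation (refuteArrow m n m≥3 n≥3)) ,
  -- The degree 89 is the same for all n.
  λ n n≥3 → monomial 89 , λ m m≥3 → toRefutation
    (relax (≤-reflexive (sym (evalPoly-monomial 89 ∣ Arrow m n ∣))) (refuteArrow m n m≥3 n≥3))
  where
  open Collapse (inst 3 3 ≤-refl ≤-refl) (λ x → objects≥3 x , agents≥3 x)
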